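{- Let $n_1\ge3$ be odd, let $k\in\mathbb N$, $n_2=2^k$, and let $M$ be the sub-add move matrix. Then $\Gamma_{M,\,n_1n_2}$ contains $n_1^2$ pairwise vertex-disjoint copies of $\Gamma_{M,\,n_2}$. Furthermore, $\Gamma_{M,\,n_1n_2}$ and $\Gamma_{M,\,n_1}$ have the same number of weakly connected components.
   Context: The sub-add move matrix is $M=\begin{pmatrix}1&-1\\1&1\end{pmatrix}$. For $n\in\mathbb N$, $\Gamma_{M,\,n}$ is the directed graph with vertex set $\mathbb Z_n^2$ and arcs $((a,b),(a-b,a+b))$ for all $(a,b)\in\mathbb Z_n^2$ (computed mod $n$; loops allowed). A weakly connected component of a directed graph is a connected component of its underlying undirected graph.
   Formalization: A "copy" of Γ_{M,n₂} is taken without its loop at (0,0): only arcs between distinct vertices must be preserved; with loops the claim is false, since Γ_{M,n₁n₂} has exactly one loop. -}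

module Defs where

open import Data.Fin using (Fin; toℕ; fromℕ<)
open import Data.Fin.Properties using (nonZeroIndex)
open import Data.Integer using (ℤ; +_; -_; 1ℤ; _+_; _*_)
open import Data.Integer.DivMod using (_%ℕ_; n%ℕd<d)
open import Data.Nat using (ℕ; NonZero)
open import Data.Product using (_×_; _,_)
open import Data.Vec using (Vec; []; _∷_)
open import Function.Bundles using (Inverse)
open import Function.Definitions using (Injective)
open import Level using (0ℓ)
open import Relation.Binary.Bundles using (Setoid)
open import Relation.Binary.Core using (Rel)
import Relation.Binary.Construct.Closure.Equivalence as EqClosure
open import Relation.Binary.PropositionalEquality as ≡ using (_≡_; _≢_)

record Digraph : Set₁ where
  field
    Vertex : Set
    Arc    : Rel Vertex 0ℓ

open Digraph public

-- Weak connectivity: the equivalence closure of the arc relation, i.e. a walk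
-- that may traverse arcs in either direction.
weakComponents : Digraph → Setoid 0ℓ 0ℓ
weakComponents G = EqClosure.setoid (Arc G)

HasWeakComponents : Digraph → ℕ → Set
HasWeakComponents G c = Inverse (weakComponents G) (≡.setoid (Fin c))

-- A (not necessarily induced) copy of H in G, where the loops of H are
-- disregarded: only arcs between distinct vertices have to be present in G.
-- Loops cannot be retained for the graphs Γ below: Γ subAdd n has a loop only
-- at (0 , 0), so it never contains two disjoint copies of a graph with a loop.
record Copy (H G : Digraph) : Set where
  field
    embed     : Vertex H → Vertex G
    injective : Injective _≡_ _≡_ embed
    arc       : ∀ {u v} → u ≢ v → Arc H u v → Arc G (embed u) (embed v)

open Copy public

VertexDisjoint : ∀ {H G} → Copy H G → Copy H G → Set
VertexDisjoint f g = ∀ u v → embed f u ≢ embed g v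

Matrix₂ : Set
Matrix₂ = Vec (Vec ℤ 2) 2

subAdd : Matrix₂
subAdd = (1ℤ ∷ - 1ℤ ∷ [])
       ∷ (1ℤ ∷   1ℤ ∷ [])
       ∷ []

-- ℤ_n is represented by Fin n (residues 0, …, n - 1).
residue : (n : ℕ) .{{_ : NonZero n}} → ℤ → Fin n
residue n z = fromℕ< (n%ℕd<d z n)

move : Matrix₂ → ∀ {n} → Fin n × Fin n → Fin n × Fin n
move ((p ∷ q ∷ []) ∷ (r ∷ s ∷ []) ∷ []) {n} (a , b) =
    residue n (p * + toℕ a + q * + toℕ b)
  , residue n (r * + toℕ a + s * + toℕ b)
  where instance n≢0 = nonZeroIndex a

Γ : Matrix₂ → ℕ → Digraph
Γ M n = record
  { Vertex = Fin n × Fin n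
  ; Arc    = λ u v → move M u ≡ v
  }

{-# OPTIONS --safe #-}

-- The arc map of Γ subAdd n is induced by the ℤ-linear map step of ℤ². Since
-- step² is twice a rotation, step^(2k) carries nℤ² into (n 2^k)ℤ². Hence every
-- walk of length 2k in Γ subAdd (2^k) ends at the fixed point, and step^(2k)
-- induces a well-defined map from Γ subAdd n₁ to Γ subAdd (n₁ 2^k). Its
-- composites with the reduction modulo n₁ move every vertex 2k arcs along its
-- walk, so the two maps are mutually inverse on weak components.
--
-- For the copies, let level u be the number of t < 2k such that the t-th iterate
-- of u is the fixed point of Γ subAdd (2^k). An arc u → v with u ≠ v raises the
-- level by one, so u ↦ 2^k step^(level u) x + n₁ u preserves non-loop arcs, for
-- every x. Its value determines u modulo 2^k, and then x modulo n₁ because step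
-- is injective modulo an odd number.

module Submission where

open import Defs
open import Data.Fin using (Fin; toℕ; punchIn; punchOut; _≟_)
open import Data.Fin.Properties
  using (toℕ-injective; toℕ<n; fromℕ<-injective; toℕ-fromℕ<; nonZeroIndex; *↔×;
         punchInᵢ≢i; punchIn-punchOut; punchOut-punchIn; punchOut-cong)
import Data.Integer as ℤ
open import Data.Integer using (ℤ; +_; -_; 1ℤ; ∣_∣)
open import Data.Integer.Divisibility.Signed
  using (divides; ∣-trans; ∣-refl; ∣m∣n⇒∣m+n; ∣m∣n⇒∣m-n; ∣n⇒∣m*n; *-monoʳ-∣;
         ∣⇒∣ᵤ; ∣ᵤ⇒∣)
  renaming (_∣_ to _∣ℤ_)
open import Data.Integer.Coprimality using (coprime-divisor)
open import Data.Integer.DivMod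
  using (_%ℕ_; _/ℕ_; n%ℕd<d; a≡a%ℕn+[a/ℕn]*n)
import Data.Integer.Properties as ℤₚ
open import Data.Integer.Tactic.RingSolver using (solve-∀)
open import Data.List using (List; []; _∷_; map; allFin; cartesianProduct)
open import Data.List.Membership.Propositional using (_∈_)
open import Data.List.Membership.Propositional.Properties
  using (∈-map⁺; ∈-map⁻; ∈-allFin; ∈-cartesianProduct⁺)
open import Data.List.Relation.Unary.Any using (here; there)
open import Data.Nat
  using (ℕ; zero; suc; _≤_; _<_; _*_; _^_; _+_; _⊔_; NonZero)
open import Data.Nat.Coprimality as Coprimality using (Coprime)
open import Data.Nat.Divisibility using (_∣_; ∣⇒≤; ∣1⇒≡1; m∣m*n; n∣m*n)
  renaming (∣-trans to ∣ℕ-trans)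
open import Data.Nat.GeneralisedArithmetic using (fold)
open import Data.Nat.Primality using (irreducible[2])
import Data.Nat.Properties as ℕₚ
open import Data.Product
  using (_×_; Σ-syntax; ∃-syntax; _,_; proj₁; proj₂)
open import Data.Product.Properties using (≡-dec)
open import Data.Sum using (_⊎_; inj₁; inj₂)
open import Function.Base using (_∘_; id)
open import Function.Bundles using (Injection; Inverse; _↔_)
import Function.Consequences.Setoid as Consequences
import Function.Construct.Composition as Composition
import Function.Construct.Symmetry as Symmetry
open import Function.Properties.Inverse using (↔⇒↣)
open import Level using (0ℓ)
open import Relation.Binary.Bundles using (Setoid)
open import Relation.Binary.Core using (Rel; _⇒_)
import Relation.Binary.Construct.Closure.Equivalence as EqClosure
open EqClosure using (EqClosure)
open import Relation.Binary.Definitions using (DecidableEquality)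
open import Relation.Binary.PropositionalEquality
  using (_≡_; _≢_; refl; sym; trans; cong; cong₂; subst; subst₂; ≢-sym;
         isEquivalence; setoid; module ≡-Reasoning)
open import Relation.Nullary using (¬_; yes; no; contradiction)

-- Counting the classes of a finitely generated equivalence relation

private variable
  A : Set
  c : ℕ

mkInverse : ∀ {S T : Setoid 0ℓ 0ℓ} → let open Setoid in
            (f : Carrier S → Carrier T) (g : Carrier T → Carrier S) →
            (∀ {x y} → _≈_ S x y → _≈_ T (f x) (f y)) →
            (∀ {x y} → _≈_ T x y → _≈_ S (g x) (g y)) →
            (∀ y → _≈_ T (f (g y)) y) → (∀ x → _≈_ S (g (f x)) x) →
            Inverse S T
mkInverse {S = S} {T} f g f-cong g-cong fg gf = record
  { to        = f
  ; from      = g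
  ; to-cong   = f-cong
  ; from-cong = g-cong
  ; inverse   = strictlyInverseˡ⇒inverseˡ f-cong fg
              , strictlyInverseʳ⇒inverseʳ g-cong gf
  }
  where open Consequences S T

-- The quotient map that glues `i` to `j`; `punchIn i` is a section of it.
merge : ∀ {i j : Fin (suc c)} → i ≢ j → Fin (suc c) → Fin c
merge {i = i} i≢j k with i ≟ k
... | yes _  = punchOut i≢j
... | no i≢k = punchOut i≢k

merge-identifies : ∀ {i j : Fin (suc c)} (i≢j : i ≢ j) → merge i≢j i ≡ merge i≢j j
merge-identifies {i = i} {j} i≢j with i ≟ i | i ≟ j
... | no i≢i | _       = contradiction refl i≢i
... | yes _  | yes i≡j = contradiction i≡j i≢j
... | yes _  | no _    = punchOut-cong i refl

merge-punchIn : ∀ {i j : Fin (suc c)} (i≢j : i ≢ j) k → merge i≢j (punchIn i k) ≡ k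
merge-punchIn {i = i} i≢j k with i ≟ punchIn i k
... | yes eq = contradiction (sym eq) (punchInᵢ≢i i k)
... | no _   = trans (punchOut-cong i refl) (punchOut-punchIn i)

punchIn-merge : ∀ {i j : Fin (suc c)} (i≢j : i ≢ j) k →
                punchIn i (merge i≢j k) ≡ k ⊎ (i ≡ k × punchIn i (merge i≢j k) ≡ j)
punchIn-merge {i = i} i≢j k with i ≟ k
... | yes i≡k = inj₂ (i≡k , punchIn-punchOut i≢j)
... | no i≢k  = inj₁ (punchIn-punchOut i≢k)

Classes : Rel A _ → ℕ → Set
Classes R c = Inverse (EqClosure.setoid R) (setoid (Fin c))

-- A relation listed pair by pair, so that its classes can be counted by induction on the list.
Joined : List (A × A) → Rel A _
Joined es u v = (u , v) ∈ es

classes-[] : A ↔ Fin c → Classes {A} (Joined []) c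
classes-[] A↔c = mkInverse to from
  (EqClosure.gfold isEquivalence to λ ())
  (λ where refl → EqClosure.reflexive _)
  strictlyInverseˡ
  (λ x → Setoid.reflexive (EqClosure.setoid _) (strictlyInverseʳ x))
  where open Inverse A↔c

-- A further pair either lies within one class and keeps the count, or fuses two classes and lowers
-- it by one.
classes-∷ : ∀ (a b : A) es → Classes (Joined es) c →
            ∃[ d ] Classes (Joined ((a , b) ∷ es)) d
classes-∷ {A} {zero} a b es I with () ← Inverse.to I a
classes-∷ {A} {suc c} a b es I with Inverse.to I a ≟ Inverse.to I b
... | yes ia≡ib = suc c , mkInverse to from
  (EqClosure.gfold isEquivalence to λ where
    (here refl) → ia≡ib
    (there e)   → to-cong (EqClosure.return e))
  (λ where refl → EqClosure.reflexive _)
  strictlyInverseˡ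
  (EqClosure.map there ∘ strictlyInverseʳ)
  where open Inverse I
... | no ia≢ib = c , mkInverse (merge ia≢ib ∘ to) (from ∘ punchIn (to a))
  (EqClosure.gfold isEquivalence (merge ia≢ib ∘ to) λ where
    (here refl) → merge-identifies ia≢ib
    (there e)   → cong (merge ia≢ib) (to-cong (EqClosure.return e)))
  (λ where refl → EqClosure.reflexive _)
  (λ k → trans (cong (merge ia≢ib) (strictlyInverseˡ _)) (merge-punchIn ia≢ib k))
  represents
  where
  open Inverse I
  S = EqClosure.setoid (Joined ((a , b) ∷ es))
  module S = Setoid S
  lift : ∀ {u v} → EqClosure (Joined es) u v → u S.≈ v
  lift = EqClosure.map there
  represents : ∀ u → from (punchIn (to a) (merge ia≢ib (to u))) S.≈ u
  represents u with punchIn-merge ia≢ib (to u)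
  ... | inj₁ eq = S.trans (S.reflexive (cong from eq)) (lift (strictlyInverseʳ u))
  -- Here `u` is in the old class of `a`, now represented by the representative of `b`; the new pair
  -- links the two.
  ... | inj₂ (ia≡iu , eq) =
    S.trans (S.reflexive (cong from eq))
    (S.trans (lift (strictlyInverseʳ b))
    (S.trans (S.sym (EqClosure.return (here refl)))
    (S.trans (lift (Setoid.sym (EqClosure.setoid (Joined es)) (strictlyInverseʳ a)))
    (S.trans (S.reflexive (cong from ia≡iu)) (lift (strictlyInverseʳ u))))))

classes-Joined : A ↔ Fin c → ∀ es → ∃[ d ] Classes {A} (Joined es) d
classes-Joined A↔c []             = _ , classes-[] A↔c
classes-Joined A↔c ((a , b) ∷ es) = classes-∷ a b es (proj₂ (classes-Joined A↔c es))

classes-⇔ : ∀ {R S : Rel A _} → R ⇒ S → S ⇒ R → Classes R c → Classes S c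
classes-⇔ {R = R} {S} R⇒S S⇒R =
  Composition.inverse
    (mkInverse {S = EqClosure.setoid S} {EqClosure.setoid R} id id
      (EqClosure.map S⇒R) (EqClosure.map R⇒S)
      (λ _ → EqClosure.reflexive R) (λ _ → EqClosure.reflexive S))

-- Each of the finitely many vertices has exactly one outgoing arc, so the arcs form a finite list.
Γ-weakComponents : ∀ M n → ∃[ c ] HasWeakComponents (Γ M n) c
Γ-weakComponents M n =
  _ , classes-⇔ toArc fromArc (proj₂ (classes-Joined (Symmetry.inverse (*↔× {n} {n})) edges))
  where
  vertices = cartesianProduct (allFin n) (allFin n)
  edges    = map (λ u → u , move M u) vertices
  toArc : Joined edges ⇒ Arc (Γ M n)
  toArc e with _ , _ , refl ← ∈-map⁻ _ e = refl
  fromArc : Arc (Γ M n) ⇒ Joined edges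
  fromArc {u} refl = ∈-map⁺ _ (∈-cartesianProduct⁺ (∈-allFin (proj₁ u)) (∈-allFin (proj₂ u)))

-- The integer lift of the sub-add move

ℤ² : Set
ℤ² = ℤ × ℤ

infixl 6 _⊕_ _⊖_
infixl 7 _•_

_⊕_ _⊖_ : ℤ² → ℤ² → ℤ²
(a , b) ⊕ (c , d) = a ℤ.+ c , b ℤ.+ d
(a , b) ⊖ (c , d) = a ℤ.- c , b ℤ.- d

_•_ : ℕ → ℤ² → ℤ²
n • (a , b) = + n ℤ.* a , + n ℤ.* b

-- The factors `1ℤ` mirror the body of `move`, so that `move-lift` holds by `refl`.
step : ℤ² → ℤ²
step (a , b) = 1ℤ ℤ.* a ℤ.+ - 1ℤ ℤ.* b , 1ℤ ℤ.* a ℤ.+ 1ℤ ℤ.* b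

step-⊖ : ∀ z w → step (z ⊖ w) ≡ step z ⊖ step w
step-⊖ (a , b) (c , d) = cong₂ _,_ (eq₁ a b c d) (eq₂ a b c d)
  where
  eq₁ : ∀ a b c d → 1ℤ ℤ.* (a ℤ.- c) ℤ.+ - 1ℤ ℤ.* (b ℤ.- d)
      ≡ (1ℤ ℤ.* a ℤ.+ - 1ℤ ℤ.* b) ℤ.- (1ℤ ℤ.* c ℤ.+ - 1ℤ ℤ.* d)
  eq₁ = solve-∀
  eq₂ : ∀ a b c d → 1ℤ ℤ.* (a ℤ.- c) ℤ.+ 1ℤ ℤ.* (b ℤ.- d)
      ≡ (1ℤ ℤ.* a ℤ.+ 1ℤ ℤ.* b) ℤ.- (1ℤ ℤ.* c ℤ.+ 1ℤ ℤ.* d)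
  eq₂ = solve-∀

step-combination : ∀ p q z w → step (p • z ⊕ q • w) ≡ p • step z ⊕ q • step w
step-combination p q (a , b) (c , d) =
  cong₂ _,_ (eq₁ (+ p) (+ q) a b c d) (eq₂ (+ p) (+ q) a b c d)
  where
  eq₁ : ∀ p q a b c d →
        1ℤ ℤ.* (p ℤ.* a ℤ.+ q ℤ.* c) ℤ.+ - 1ℤ ℤ.* (p ℤ.* b ℤ.+ q ℤ.* d)
      ≡ p ℤ.* (1ℤ ℤ.* a ℤ.+ - 1ℤ ℤ.* b) ℤ.+ q ℤ.* (1ℤ ℤ.* c ℤ.+ - 1ℤ ℤ.* d)
  eq₁ = solve-∀
  eq₂ : ∀ p q a b c d →
        1ℤ ℤ.* (p ℤ.* a ℤ.+ q ℤ.* c) ℤ.+ 1ℤ ℤ.* (p ℤ.* b ℤ.+ q ℤ.* d)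
      ≡ p ℤ.* (1ℤ ℤ.* a ℤ.+ 1ℤ ℤ.* b) ℤ.+ q ℤ.* (1ℤ ℤ.* c ℤ.+ 1ℤ ℤ.* d)
  eq₂ = solve-∀

fold-step-⊖ : ∀ t z w → fold (z ⊖ w) step t ≡ fold z step t ⊖ fold w step t
fold-step-⊖ zero    z w = refl
fold-step-⊖ (suc t) z w = trans (cong step (fold-step-⊖ t z w))
                                (step-⊖ (fold z step t) (fold w step t))

fold-shift : ∀ {A : Set} (f : A → A) x t → fold (f x) f t ≡ f (fold x f t)
fold-shift f x zero    = refl
fold-shift f x (suc t) = cong f (fold-shift f x t)

-- Divisibility and congruence in ℤ²

infix 4 _∣²_ _≡_[mod_]

_∣²_ : ℕ → ℤ² → Set
n ∣² (a , b) = + n ∣ℤ a × + n ∣ℤ b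

_≡_[mod_] : ℤ² → ℤ² → ℕ → Set
z ≡ w [mod n ] = n ∣² (z ⊖ w)

∣²-step : ∀ {n} z → n ∣² z → n ∣² step z
∣²-step _ (n∣a , n∣b) = ∣m∣n⇒∣m+n (∣n⇒∣m*n 1ℤ n∣a) (∣n⇒∣m*n (- 1ℤ) n∣b)
                      , ∣m∣n⇒∣m+n (∣n⇒∣m*n 1ℤ n∣a) (∣n⇒∣m*n 1ℤ n∣b)

∣ℤ-double : ∀ {n a} → + n ∣ℤ a → + (2 * n) ∣ℤ + 2 ℤ.* a
∣ℤ-double {n} n∣a = subst (_∣ℤ _) (sym (ℤₚ.pos-* 2 n)) (*-monoʳ-∣ (+ 2) n∣a)

-- Two steps send (a, b) to (-2b, 2a), a quarter turn scaled by 2.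
∣²-step² : ∀ {n} z → n ∣² z → 2 * n ∣² step (step z)
∣²-step² {n} (a , b) (n∣a , n∣b) =
    subst (_ ∣ℤ_) (eq₁ a b) (∣n⇒∣m*n (- 1ℤ) (∣ℤ-double n∣b))
  , subst (_ ∣ℤ_) (eq₂ a b) (∣ℤ-double n∣a)
  where
  eq₁ : ∀ a b → - 1ℤ ℤ.* (+ 2 ℤ.* b) ≡
        1ℤ ℤ.* (1ℤ ℤ.* a ℤ.+ - 1ℤ ℤ.* b) ℤ.+ - 1ℤ ℤ.* (1ℤ ℤ.* a ℤ.+ 1ℤ ℤ.* b)
  eq₁ = solve-∀
  eq₂ : ∀ a b → + 2 ℤ.* a ≡
        1ℤ ℤ.* (1ℤ ℤ.* a ℤ.+ - 1ℤ ℤ.* b) ℤ.+ 1ℤ ℤ.* (1ℤ ℤ.* a ℤ.+ 1ℤ ℤ.* b)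
  eq₂ = solve-∀

∣²-fold-step : ∀ {n} k z → n ∣² z → n * 2 ^ k ∣² fold z step (k * 2)
∣²-fold-step {n} zero    z n∣z = subst (_∣² z) (sym (ℕₚ.*-identityʳ n)) n∣z
∣²-fold-step {n} (suc k) z n∣z =
  -- The exponent is `k * 2` rather than `2 * k`, so that `suc k * 2` unfolds to two further steps.
  subst (_∣² fold z step (suc k * 2)) eq (∣²-step² _ (∣²-fold-step k z n∣z))
  where
  eq : 2 * (n * 2 ^ k) ≡ n * 2 ^ suc k
  eq = begin
    2 * (n * 2 ^ k) ≡⟨ ℕₚ.*-assoc 2 n (2 ^ k) ⟨
    2 * n * 2 ^ k   ≡⟨ cong (_* 2 ^ k) (ℕₚ.*-comm 2 n) ⟩
    n * 2 * 2 ^ k   ≡⟨ ℕₚ.*-assoc n 2 (2 ^ k) ⟩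
    n * 2 ^ suc k   ∎
    where open ≡-Reasoning

1∣² : ∀ z → 1 ∣² z
1∣² (a , b) = divides a (sym (ℤₚ.*-identityʳ a)) , divides b (sym (ℤₚ.*-identityʳ b))

≡mod-weaken : ∀ {m n z w} → m ∣ n → z ≡ w [mod n ] → z ≡ w [mod m ]
≡mod-weaken {m} {n} m∣n (p , q) = ∣-trans m∣ℤn p , ∣-trans m∣ℤn q
  where
  m∣ℤn : + m ∣ℤ + n
  m∣ℤn = ∣ᵤ⇒∣ m∣n

step-cong-mod : ∀ {n} z w → z ≡ w [mod n ] → step z ≡ step w [mod n ]
step-cong-mod {n} z w z≡w = subst (n ∣²_) (step-⊖ z w) (∣²-step _ z≡w)

fold-step-cong-mod : ∀ {n} k z w → z ≡ w [mod n ] →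
                     fold z step (k * 2) ≡ fold w step (k * 2) [mod n * 2 ^ k ]
fold-step-cong-mod k z w z≡w =
  subst (_ ∣²_) (fold-step-⊖ (k * 2) z w) (∣²-fold-step k (z ⊖ w) z≡w)

-- Residues

residue-injective : ∀ {n} .{{_ : NonZero n}} a b → residue n a ≡ residue n b → + n ∣ℤ a ℤ.- b
residue-injective {n} a b eq = divides (a /ℕ n ℤ.- b /ℕ n) (begin
  a ℤ.- b
    ≡⟨ cong₂ ℤ._-_ (a≡a%ℕn+[a/ℕn]*n a n) (a≡a%ℕn+[a/ℕn]*n b n) ⟩
  (+ (a %ℕ n) ℤ.+ a /ℕ n ℤ.* + n) ℤ.- (+ (b %ℕ n) ℤ.+ b /ℕ n ℤ.* + n)
    ≡⟨ cong (λ r → (+ (a %ℕ n) ℤ.+ a /ℕ n ℤ.* + n) ℤ.- (+ r ℤ.+ b /ℕ n ℤ.* + n))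
         (fromℕ<-injective _ _ (n%ℕd<d a n) (n%ℕd<d b n) eq) ⟨
  (+ (a %ℕ n) ℤ.+ a /ℕ n ℤ.* + n) ℤ.- (+ (a %ℕ n) ℤ.+ b /ℕ n ℤ.* + n)
    ≡⟨ cancel (+ (a %ℕ n)) (a /ℕ n) (b /ℕ n) (+ n) ⟩
  (a /ℕ n ℤ.- b /ℕ n) ℤ.* + n ∎)
  where
  open ≡-Reasoning
  cancel : ∀ r p q m → (r ℤ.+ p ℤ.* m) ℤ.- (r ℤ.+ q ℤ.* m) ≡ (p ℤ.- q) ℤ.* m
  cancel = solve-∀

∣ℤ-toℕ-residue : ∀ {n} .{{_ : NonZero n}} a → + n ∣ℤ + toℕ (residue n a) ℤ.- a
∣ℤ-toℕ-residue {n} a = divides (- (a /ℕ n)) (begin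
  + toℕ (residue n a) ℤ.- a
    ≡⟨ cong₂ (λ r x → + r ℤ.- x) (toℕ-fromℕ< (n%ℕd<d a n)) (a≡a%ℕn+[a/ℕn]*n a n) ⟩
  + (a %ℕ n) ℤ.- (+ (a %ℕ n) ℤ.+ a /ℕ n ℤ.* + n)
    ≡⟨ cancel (+ (a %ℕ n)) (a /ℕ n) (+ n) ⟩
  - (a /ℕ n) ℤ.* + n ∎)
  where
  open ≡-Reasoning
  cancel : ∀ r p m → r ℤ.- (r ℤ.+ p ℤ.* m) ≡ - p ℤ.* m
  cancel = solve-∀

∣∧<⇒≡0 : ∀ {m n} → m ∣ n → n < m → n ≡ 0
∣∧<⇒≡0 {n = zero}  _   _   = refl
∣∧<⇒≡0 {n = suc _} m∣n n<m = contradiction (∣⇒≤ m∣n) (ℕₚ.<⇒≱ n<m)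

-- Representatives below `n` differ by less than `n` in absolute value, and the only such multiple
-- of `n` is 0.
toℕ-injective-mod : ∀ {n} (i j : Fin n) → + n ∣ℤ + toℕ i ℤ.- + toℕ j → i ≡ j
toℕ-injective-mod {n} i j n∣i-j =
  toℕ-injective (ℤₚ.+-injective (ℤₚ.i-j≡0⇒i≡j _ _ (ℤₚ.∣i∣≡0⇒i≡0
    (∣∧<⇒≡0 (∣⇒∣ᵤ n∣i-j) small))))
  where
  open ℕₚ.≤-Reasoning
  small : ∣ + toℕ i ℤ.- + toℕ j ∣ < n
  small = begin-strict
    ∣ + toℕ i ℤ.- + toℕ j ∣ ≡⟨ cong ∣_∣ (ℤₚ.m-n≡m⊖n (toℕ i) (toℕ j)) ⟩
    ∣ toℕ i ℤ.⊖ toℕ j ∣     ≤⟨ ℤₚ.∣m⊝n∣≤m⊔n (toℕ i) (toℕ j) ⟩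
    toℕ i ⊔ toℕ j           <⟨ ℕₚ.⊔-pres-<m (toℕ<n i) (toℕ<n j) ⟩
    n                       ∎

residue-cong : ∀ {n} .{{_ : NonZero n}} a b → + n ∣ℤ a ℤ.- b → residue n a ≡ residue n b
residue-cong {n} a b n∣a-b = toℕ-injective-mod _ _
  (subst (_ ∣ℤ_) (telescope (+ toℕ (residue n a)) a b (+ toℕ (residue n b)))
    (∣m∣n⇒∣m-n (∣m∣n⇒∣m+n (∣ℤ-toℕ-residue a) n∣a-b) (∣ℤ-toℕ-residue b)))
  where
  telescope : ∀ r a b s → ((r ℤ.- a) ℤ.+ (a ℤ.- b)) ℤ.- (s ℤ.- b) ≡ r ℤ.- s
  telescope = solve-∀

-- Vertices as residue classes of ℤ²

private variable
  n : ℕ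

lift : Fin n × Fin n → ℤ²
lift (a , b) = + toℕ a , + toℕ b

reduce : ∀ n .{{_ : NonZero n}} → ℤ² → Fin n × Fin n
reduce n (a , b) = residue n a , residue n b

reduce-cong : .{{_ : NonZero n}} → ∀ z w → z ≡ w [mod n ] → reduce n z ≡ reduce n w
reduce-cong (a , b) (c , d) (p , q) = cong₂ _,_ (residue-cong a c p) (residue-cong b d q)

reduce-injective : .{{_ : NonZero n}} → ∀ z w → reduce n z ≡ reduce n w → z ≡ w [mod n ]
reduce-injective (a , b) (c , d) eq =
  residue-injective a c (cong proj₁ eq) , residue-injective b d (cong proj₂ eq)

lift-reduce : .{{_ : NonZero n}} → ∀ z → lift (reduce n z) ≡ z [mod n ]
lift-reduce (a , b) = ∣ℤ-toℕ-residue a , ∣ℤ-toℕ-residue b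

lift-injective-mod : ∀ (u v : Fin n × Fin n) → lift u ≡ lift v [mod n ] → u ≡ v
lift-injective-mod (a , b) (c , d) (p , q) =
  cong₂ _,_ (toℕ-injective-mod a c p) (toℕ-injective-mod b d q)

reduce-lift : .{{_ : NonZero n}} → ∀ u → reduce n (lift u) ≡ u
reduce-lift u = lift-injective-mod _ u (lift-reduce (lift u))

-- The two sides use different `NonZero` proofs, but that argument of `residue` is irrelevant.
move-lift : .{{_ : NonZero n}} → ∀ u → move subAdd u ≡ reduce n (step (lift u))
move-lift u = refl

lift-move : ∀ (u : Fin n × Fin n) → lift (move subAdd u) ≡ step (lift u) [mod n ]
lift-move u = lift-reduce {{nonZeroIndex (proj₁ u)}} (step (lift u))

-- Congruent points have congruent images under `step`, so reduction intertwines `step` with the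
-- move, and walks can be computed in ℤ².
move-reduce : .{{_ : NonZero n}} → ∀ z → move subAdd (reduce n z) ≡ reduce n (step z)
move-reduce {n} z = trans (move-lift (reduce n z))
  (reduce-cong (step (lift (reduce n z))) (step z)
    (step-cong-mod (lift (reduce n z)) z (lift-reduce z)))

fold-move-reduce : .{{_ : NonZero n}} → ∀ z t →
                   fold (reduce n z) (move subAdd) t ≡ reduce n (fold z step t)
fold-move-reduce z zero    = refl
fold-move-reduce z (suc t) =
  trans (cong (move subAdd) (fold-move-reduce z t)) (move-reduce (fold z step t))

fold-move : .{{_ : NonZero n}} → ∀ u t →
            fold u (move subAdd) t ≡ reduce n (fold (lift u) step t)
fold-move u t = trans (cong (λ v → fold v (move subAdd) t) (sym (reduce-lift u)))
                      (fold-move-reduce (lift u) t)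

-- Weak components of Γ subAdd (n * 2 ^ k) and of Γ subAdd n

walk : ∀ (u : Fin n × Fin n) t → EqClosure (Arc (Γ subAdd n)) u (fold u (move subAdd) t)
walk         u zero    = EqClosure.reflexive _
walk {n = n} u (suc t) =
  EqClosure.transitive _ (walk u t) (EqClosure.return {R = Arc (Γ subAdd n)} refl)

module _ (n k : ℕ) .{{n≢0 : NonZero n}} where

  private
    instance
      2^k≢0 : NonZero (2 ^ k)
      2^k≢0 = ℕₚ.m^n≢0 2 k
      n2^k≢0 : NonZero (n * 2 ^ k)
      n2^k≢0 = ℕₚ.m*n≢0 n (2 ^ k)

    n∣n2^k : n ∣ n * 2 ^ k
    n∣n2^k = m∣m*n (2 ^ k)

    G = Γ subAdd (n * 2 ^ k)
    H = Γ subAdd n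

    down : Vertex G → Vertex H
    down w = reduce n (lift w)

    up : Vertex H → Vertex G
    up x = reduce (n * 2 ^ k) (fold (lift x) step (k * 2))

    down-reduce : ∀ z → down (reduce (n * 2 ^ k) z) ≡ reduce n z
    down-reduce z = reduce-cong (lift (reduce (n * 2 ^ k) z)) z
      (≡mod-weaken {z = lift (reduce (n * 2 ^ k) z)} {z} n∣n2^k (lift-reduce z))

    -- Independence of the representative: a change in nℤ² becomes, after `k * 2` steps, a change in
    -- (n 2^k)ℤ².
    up-reduce : ∀ z → up (reduce n z) ≡ reduce (n * 2 ^ k) (fold z step (k * 2))
    up-reduce z = reduce-cong
      (fold (lift (reduce n z)) step (k * 2)) (fold z step (k * 2))
      (fold-step-cong-mod k (lift (reduce n z)) z (lift-reduce z))

    down-move : ∀ {u v} → Arc G u v → Arc H (down u) (down v)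
    down-move {u} refl = trans (move-reduce (lift u)) (sym (down-reduce (step (lift u))))

    up-move : ∀ {u v} → Arc H u v → Arc G (up u) (up v)
    up-move {u} refl = begin
      move subAdd (up u)
        ≡⟨ move-reduce (fold (lift u) step (k * 2)) ⟩
      reduce _ (step (fold (lift u) step (k * 2)))
        ≡⟨ cong (reduce _) (fold-shift step (lift u) (k * 2)) ⟨
      reduce _ (fold (step (lift u)) step (k * 2))
        -- The vertex `move subAdd u` is `reduce n (step (lift u))`, so `step (lift u)` may serve as
        -- its representative.
        ≡⟨ up-reduce (step (lift u)) ⟨
      up (move subAdd u) ∎
      where open ≡-Reasoning

    down-up : ∀ x → down (up x) ≡ fold x (move subAdd) (k * 2)
    down-up x = trans (down-reduce (fold (lift x) step (k * 2))) (sym (fold-move x (k * 2)))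

    up-down : ∀ w → up (down w) ≡ fold w (move subAdd) (k * 2)
    up-down w = trans (up-reduce (lift w)) (sym (fold-move w (k * 2)))

  weakComponents-Γ-2^k : Inverse (weakComponents (Γ subAdd (n * 2 ^ k)))
                                 (weakComponents (Γ subAdd n))
  weakComponents-Γ-2^k = mkInverse down up
    (EqClosure.gmap down down-move) (EqClosure.gmap up up-move)
    (λ x → subst (λ y → EqClosure (Arc H) y x) (sym (down-up x))
             (EqClosure.symmetric _ (walk x (k * 2))))
    (λ w → subst (λ y → EqClosure (Arc G) y w) (sym (up-down w))
             (EqClosure.symmetric _ (walk w (k * 2))))

-- Copies of Γ subAdd (2 ^ k)

module _ {A : Set} (_≟ᴬ_ : DecidableEquality A) (f : A → A) where

  fixed : A → ℕ
  fixed u with f u ≟ᴬ u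
  ... | yes _ = 1
  ... | no _  = 0

  fixed-yes : ∀ {u} → f u ≡ u → fixed u ≡ 1
  fixed-yes {u} eq with f u ≟ᴬ u
  ... | yes _ = refl
  ... | no ne = contradiction eq ne

  fixed-no : ∀ {u} → f u ≢ u → fixed u ≡ 0
  fixed-no {u} ne with f u ≟ᴬ u
  ... | yes eq = contradiction eq ne
  ... | no _   = refl

  -- If the orbit of `u` first meets a fixed point at time r ≤ t, this is t - r, because the orbit
  -- stays there.
  fixedCount : ℕ → A → ℕ
  fixedCount zero    u = 0
  fixedCount (suc t) u = fixed (fold u f t) + fixedCount t u

  -- Both sides count the fixed points among the t + 1 terms from `u` to `fold u f t`.
  fixedCount-shift : ∀ t u →
                     fixedCount t (f u) + fixed u ≡ fixed (fold u f t) + fixedCount t u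
  fixedCount-shift zero    u = sym (ℕₚ.+-identityʳ (fixed u))
  fixedCount-shift (suc t) u = begin
    fixed (fold (f u) f t) + fixedCount t (f u) + fixed u
      ≡⟨ ℕₚ.+-assoc (fixed (fold (f u) f t)) _ _ ⟩
    fixed (fold (f u) f t) + (fixedCount t (f u) + fixed u)
      ≡⟨ cong₂ (λ x m → fixed x + m) (fold-shift f u t) (fixedCount-shift t u) ⟩
    fixed (fold u f (suc t)) + fixedCount (suc t) u ∎
    where open ≡-Reasoning

  -- Shifting the window by one drops `u`, which is not fixed, and gains `fold u f t`, which is.
  fixedCount-suc : ∀ t u → f (fold u f t) ≡ fold u f t → f u ≢ u →
                   fixedCount t (f u) ≡ suc (fixedCount t u)
  fixedCount-suc t u end start = begin
    fixedCount t (f u)                  ≡⟨ ℕₚ.+-identityʳ _ ⟨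
    fixedCount t (f u) + 0              ≡⟨ cong (λ m → fixedCount t (f u) + m) (fixed-no start) ⟨
    fixedCount t (f u) + fixed u        ≡⟨ fixedCount-shift t u ⟩
    fixed (fold u f t) + fixedCount t u ≡⟨ cong (_+ fixedCount t u) (fixed-yes end) ⟩
    suc (fixedCount t u)                ∎
    where open ≡-Reasoning

-- Cancellation and combination modulo coprime numbers

odd⇒coprime-2 : ∀ {n} → ¬ (2 ∣ n) → Coprime n 2
odd⇒coprime-2 2∤n (d∣n , d∣2) with irreducible[2] d∣2
... | inj₁ d≡1  = d≡1
... | inj₂ refl = contradiction d∣n 2∤n

coprime-^ : ∀ {m n} → Coprime m n → ∀ k → Coprime m (n ^ k)
coprime-^ c zero    (_ , d∣1) = ∣1⇒≡1 d∣1
coprime-^ c (suc k) (d∣m , d∣n*n^k) =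
  coprime-^ c k (d∣m , Coprimality.coprime-divisor
    (λ (e∣d , e∣n) → c (∣ℕ-trans e∣d d∣m , e∣n)) d∣n*n^k)

∣ℤ-cancel-coprime : ∀ {m n} a → Coprime m n → + m ∣ℤ + n ℤ.* a → + m ∣ℤ a
∣ℤ-cancel-coprime {m} {n} a c m∣na =
  ∣ᵤ⇒∣ (coprime-divisor (+ m) (+ n) a c (∣⇒∣ᵤ m∣na))

-- Sum and difference of the coordinates of `step (a , b)` are 2a and 2b, and 2 cancels modulo an
-- odd number.
∣²-step-cancel : ∀ {n} → ¬ (2 ∣ n) → ∀ z → n ∣² step z → n ∣² z
∣²-step-cancel 2∤n (a , b) (p , q) =
    ∣ℤ-cancel-coprime a (odd⇒coprime-2 2∤n) (subst (_ ∣ℤ_) (eq₁ a b) (∣m∣n⇒∣m+n p q))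
  , ∣ℤ-cancel-coprime b (odd⇒coprime-2 2∤n) (subst (_ ∣ℤ_) (eq₂ a b) (∣m∣n⇒∣m-n q p))
  where
  eq₁ : ∀ a b → (1ℤ ℤ.* a ℤ.+ - 1ℤ ℤ.* b) ℤ.+ (1ℤ ℤ.* a ℤ.+ 1ℤ ℤ.* b) ≡ + 2 ℤ.* a
  eq₁ = solve-∀
  eq₂ : ∀ a b → (1ℤ ℤ.* a ℤ.+ 1ℤ ℤ.* b) ℤ.- (1ℤ ℤ.* a ℤ.+ - 1ℤ ℤ.* b) ≡ + 2 ℤ.* b
  eq₂ = solve-∀

∣²-fold-step-cancel : ∀ {n} → ¬ (2 ∣ n) → ∀ t z → n ∣² fold z step t → n ∣² z
∣²-fold-step-cancel 2∤n zero    z n∣z = n∣z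
∣²-fold-step-cancel 2∤n (suc t) z n∣z =
  ∣²-fold-step-cancel 2∤n t z (∣²-step-cancel 2∤n (fold z step t) n∣z)

-- Modulo `p` the first summands vanish, and the coprime factor `q` cancels.
combination-modʳ : ∀ {p q} → Coprime p q → ∀ z w z′ w′ →
                   (p • z ⊕ q • w) ≡ (p • z′ ⊕ q • w′) [mod p ] → w ≡ w′ [mod p ]
combination-modʳ {p} {q} c (a , b) (d , e) (a′ , b′) (d′ , e′) (h₁ , h₂) =
  component a d a′ d′ h₁ , component b e b′ e′ h₂
  where
  eq : ∀ p q a d a′ d′ →
       ((p ℤ.* a ℤ.+ q ℤ.* d) ℤ.- (p ℤ.* a′ ℤ.+ q ℤ.* d′)) ℤ.- (a ℤ.- a′) ℤ.* p
     ≡ q ℤ.* (d ℤ.- d′)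
  eq = solve-∀
  component : ∀ a d a′ d′ →
              + p ∣ℤ (+ p ℤ.* a ℤ.+ + q ℤ.* d) ℤ.- (+ p ℤ.* a′ ℤ.+ + q ℤ.* d′) →
              + p ∣ℤ d ℤ.- d′
  component a d a′ d′ h = ∣ℤ-cancel-coprime (d ℤ.- d′) c
    (subst (_ ∣ℤ_) (eq (+ p) (+ q) a d a′ d′) (∣m∣n⇒∣m-n h (∣n⇒∣m*n (a ℤ.- a′) ∣-refl)))

⊕-comm : ∀ z w → z ⊕ w ≡ w ⊕ z
⊕-comm (a , b) (c , d) = cong₂ _,_ (ℤₚ.+-comm a c) (ℤₚ.+-comm b d)

combination-modˡ : ∀ {p q} → Coprime q p → ∀ z w z′ w′ →
                   (p • z ⊕ q • w) ≡ (p • z′ ⊕ q • w′) [mod q ] → z ≡ z′ [mod q ]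
combination-modˡ {p} {q} c z w z′ w′ h = combination-modʳ c w z w′ z′
  (subst₂ (_≡_[mod q ]) (⊕-comm (p • z) (q • w)) (⊕-comm (p • z′) (q • w′)) h)

-- The coefficient `q` raises the modulus from `p` to `q * p`: a vertex known only modulo 2^k still
-- determines its place modulo n 2^k.
combination-congʳ : ∀ {p q} z w w′ → w ≡ w′ [mod p ] →
                    (p • z ⊕ q • w) ≡ (p • z ⊕ q • w′) [mod q * p ]
combination-congʳ {p} {q} (a , b) (d , e) (d′ , e′) (h₁ , h₂) =
  component a d d′ h₁ , component b e e′ h₂
  where
  eq : ∀ p q a d d′ → q ℤ.* (d ℤ.- d′) ≡ (p ℤ.* a ℤ.+ q ℤ.* d) ℤ.- (p ℤ.* a ℤ.+ q ℤ.* d′)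
  eq = solve-∀
  component : ∀ a d d′ → + p ∣ℤ d ℤ.- d′ →
              + (q * p) ∣ℤ (+ p ℤ.* a ℤ.+ + q ℤ.* d) ℤ.- (+ p ℤ.* a ℤ.+ + q ℤ.* d′)
  component a d d′ h =
    subst₂ _∣ℤ_ (sym (ℤₚ.pos-* q p)) (eq (+ p) (+ q) a d d′) (*-monoʳ-∣ (+ q) h)

-- The embeddings and their disjointness

module _ (n k : ℕ) .{{n≢0 : NonZero n}} (2∤n : ¬ (2 ∣ n)) where

  private
    q = 2 ^ k

    instance
      q≢0 : NonZero q
      q≢0 = ℕₚ.m^n≢0 2 k
      nq≢0 : NonZero (n * q)
      nq≢0 = ℕₚ.m*n≢0 n q

    G = Γ subAdd (n * q)
    H = Γ subAdd q

    n-coprime-q : Coprime n q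
    n-coprime-q = coprime-^ (odd⇒coprime-2 2∤n) k

    level : Vertex H → ℕ
    level = fixedCount (≡-dec _≟_ _≟_) (move subAdd) (k * 2)

    -- All points agree modulo 1, so after `k * 2` steps all walks agree modulo 2^k; compare the
    -- walks from `u` and from `move subAdd u`.
    ends-fixed : ∀ u → let w = fold u (move subAdd) (k * 2) in move subAdd w ≡ w
    ends-fixed u = begin
      move subAdd (fold u (move subAdd) (k * 2))
        ≡⟨ fold-shift (move subAdd) u (k * 2) ⟨
      fold (move subAdd u) (move subAdd) (k * 2)
        ≡⟨ fold-move (move subAdd u) (k * 2) ⟩
      reduce q (fold (lift (move subAdd u)) step (k * 2))
        ≡⟨ reduce-cong (fold (lift (move subAdd u)) step (k * 2)) (fold (lift u) step (k * 2))
             (subst (_∣² (fold (lift (move subAdd u)) step (k * 2) ⊖ fold (lift u) step (k * 2)))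
               (ℕₚ.*-identityˡ q)
               (fold-step-cong-mod k (lift (move subAdd u)) (lift u)
                 (1∣² (lift (move subAdd u) ⊖ lift u)))) ⟩
      reduce q (fold (lift u) step (k * 2))
        ≡⟨ fold-move u (k * 2) ⟨
      fold u (move subAdd) (k * 2) ∎
      where open ≡-Reasoning

    -- A Chinese remainder combination: modulo `q` only the term in `u` survives, modulo `n` only
    -- the term in `x`.
    place : ℤ² → Vertex H → ℤ²
    place x u = q • fold x step (level u) ⊕ n • lift u

    emb : ℤ² → Vertex H → Vertex G
    emb x u = reduce (n * q) (place x u)

    emb-≡mod : ∀ x y u v → emb x u ≡ emb y v → place x u ≡ place y v [mod n * q ]
    emb-≡mod x y u v = reduce-injective (place x u) (place y v)

    -- The offsets may differ: `x = y` gives injectivity of one copy, and distinct offsets reduce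
    -- disjointness to a common vertex.
    emb-vertex : ∀ x y u v → emb x u ≡ emb y v → u ≡ v
    emb-vertex x y u v eq = lift-injective-mod u v
      (combination-modʳ (Coprimality.sym n-coprime-q)
        (fold x step (level u)) (lift u) (fold y step (level v)) (lift v)
        (≡mod-weaken {z = place x u} {place y v} (n∣m*n n)
          (emb-≡mod x y u v eq)))

    -- At a common vertex both offsets have made the same number of steps, and these can be undone
    -- modulo the odd `n`.
    emb-offset : ∀ x y u → emb x u ≡ emb y u → x ≡ y [mod n ]
    emb-offset x y u eq = ∣²-fold-step-cancel 2∤n (level u) (x ⊖ y)
      (subst (n ∣²_) (sym (fold-step-⊖ (level u) x y))
        (combination-modˡ n-coprime-q
          (fold x step (level u)) (lift u) (fold y step (level u)) (lift u)
          (≡mod-weaken {z = place x u} {place y u} (m∣m*n q)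
            (emb-≡mod x y u u eq))))

    emb-arc : ∀ x {u v} → u ≢ v → Arc H u v → Arc G (emb x u) (emb x v)
    emb-arc x {u} u≢v refl = begin
      move subAdd (emb x u)
        ≡⟨ move-reduce (place x u) ⟩
      reduce (n * q) (step (place x u))
        ≡⟨ cong (reduce (n * q)) (step-combination q n (fold x step (level u)) (lift u)) ⟩
      reduce (n * q) (q • fold x step (suc (level u)) ⊕ n • step (lift u))
        ≡⟨ reduce-cong (q • fold x step (suc (level u)) ⊕ n • lift (move subAdd u))
             (q • fold x step (suc (level u)) ⊕ n • step (lift u))
             (combination-congʳ {q} {n} (fold x step (suc (level u)))
               (lift (move subAdd u)) (step (lift u)) (lift-move u)) ⟨
      reduce (n * q) (q • fold x step (suc (level u)) ⊕ n • lift (move subAdd u))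
        -- As `u` is not fixed, the arc raises the level by one, which accounts for the extra step
        -- on `x`.
        ≡⟨ cong (λ t → reduce (n * q) (q • fold x step t ⊕ n • lift (move subAdd u)))
             (fixedCount-suc _ (move subAdd) (k * 2) u (ends-fixed u) (≢-sym u≢v)) ⟨
      emb x (move subAdd u) ∎
      where open ≡-Reasoning

  copy : Fin n × Fin n → Copy (Γ subAdd (2 ^ k)) (Γ subAdd (n * 2 ^ k))
  copy x = record
    { embed     = emb (lift x)
    ; injective = λ {u} {v} → emb-vertex (lift x) (lift x) u v
    ; arc       = emb-arc (lift x)
    }

  copy-disjoint : ∀ x y → x ≢ y → VertexDisjoint (copy x) (copy y)
  copy-disjoint x y x≢y u v eq = x≢y (lift-injective-mod x y
    (emb-offset (lift x) (lift y) u
      (trans eq (cong (emb (lift y)) (sym (emb-vertex (lift x) (lift y) u v eq))))))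

-- The power `n ^ 2` unfolds to `n * (n * 1)`, hence the transport.
pairOfIndex : Fin (n ^ 2) ↔ (Fin n × Fin n)
pairOfIndex {n} = subst (λ m → Fin m ↔ (Fin n × Fin n))
  (cong (n *_) (sym (ℕₚ.*-identityʳ n))) *↔×

theorem6p3 : ∀ (n₁ k : ℕ) → 3 ≤ n₁ → ¬ (2 ∣ n₁) →
    (Σ[ f ∈ (Fin (n₁ ^ 2) → Copy (Γ subAdd (2 ^ k)) (Γ subAdd (n₁ * 2 ^ k))) ]
    (∀ i j → i ≢ j → VertexDisjoint (f i) (f j)))
    × (∃[ c ] (HasWeakComponents (Γ subAdd (n₁ * 2 ^ k)) c
    × HasWeakComponents (Γ subAdd n₁) c))
-- Matching on `suc _` supplies the `NonZero` instance; zero contradicts `3 ≤ n₁`.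
theorem6p3 n₁@(suc _) k 3≤n₁ 2∤n₁ =
    ( copy n₁ k 2∤n₁ ∘ to
    , λ i j i≢j → copy-disjoint n₁ k 2∤n₁ (to i) (to j)
        (i≢j ∘ Injection.injective (↔⇒↣ pairOfIndex)))
  -- The classes are counted in the graph modulo `n₁`, and the count is carried over by the
  -- bijection of components.
  , let c , components = Γ-weakComponents subAdd n₁
    in c , Composition.inverse (weakComponents-Γ-2^k n₁ k) components , components
  where open Inverse (pairOfIndex {n₁}) using (to)
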